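{- Let $f:\{0,1\}^2\to\{0,1\}$ be a Boolean function of two variables. Then $ess(f)=2$ and $gap(f)=2$ (i.e. $f\in G_2^2$) if and only if there are $a_0,a_1,a_2\in\{0,1\}$ with $a_1\neq a_0$ or $a_2\neq a_0$ such that $$f=a_0\cdot(x_1^0x_2^0\oplus x_1^1x_2^1)\oplus a_1\cdot x_1^0x_2^1\oplus a_2\cdot x_1^1x_2^0.$$
   Context: $B=\{0,1\}$ is the ring of residues modulo $2$, with addition $\oplus$ and multiplication modulo $2$. $P_2^n$ is the set of all functions $f:B^n\to B$, with variables $x_1,\ldots,x_n$. For $\alpha\in B$, $x^\alpha=1$ if $x=\alpha$ and $x^\alpha=0$ otherwise. A variable $x_i$ is essential in $f$ if changing the $i$-th argument alone changes the value of $f$ at some point; $Ess(f)$ is the set of essential variables and $ess(f)=|Ess(f)|$. For $i\neq j$, the identification minor $f_{i\leftarrow j}$ is the function obtained from $f$ by substituting $x_j$ for $x_i$ (regarded as a function of $x_1,\ldots,x_n$). The essential arity gap is $gap(f)=ess(f)-\max ess(f_{i\leftarrow j})$, the maximum being over all pairs of distinct essential variables $x_i,x_j$ of $f$. $G_2^2$ is the set of $f\in P_2^2$ with $ess(f)=2$ and $gap(f)=2$. -}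

module Defs where

open import Data.Bool using (Bool; not; _≟_)
open import Data.Fin using (Fin)
import Data.Fin as Fin
open import Data.Fin.Subset using (Subset; ∣_∣)
open import Data.Fin.Subset.Properties using (anySubset?; _∈?_)
open import Data.List using (List; map; filter; allFin; cartesianProduct)
open import Data.List.Extrema.Nat using (max)
open import Data.Nat using (ℕ; _∸_)
open import Data.Product using (_×_; _,_; ∃)
open import Data.Vec using (Vec; tabulate; lookup; updateAt; _[_]≔_)
open import Relation.Binary.PropositionalEquality using (_≢_)
open import Relation.Nullary using (Dec; does; ¬?; _×-dec_)

-- B = {0,1} is Bool with 0 = false and 1 = true; its ring operations are
-- _xor_ and _∧_ (xor-∧-commutativeRing in Data.Bool.Properties).
-- The variable x_{k+1} corresponds to the index k : Fin n.

P₂ : ℕ → Set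
P₂ n = Vec Bool n → Bool

infix 8 _^_

_^_ : Bool → Bool → Bool
x ^ α = does (x ≟ α)

Essential : ∀ {n} → P₂ n → Fin n → Set
Essential f i = ∃ λ x → f (updateAt x i not) ≢ f x

-- anySubset? searches all of Vec Bool n, since Subset n is that type.
essential? : ∀ {n} (f : P₂ n) (i : Fin n) → Dec (Essential f i)
essential? f i = anySubset? λ x → ¬? (f (updateAt x i not) ≟ f x)

Ess : ∀ {n} → P₂ n → Subset n
Ess f = tabulate λ i → does (essential? f i)

ess : ∀ {n} → P₂ n → ℕ
ess f = ∣ Ess f ∣

infix 9 _⟨_←_⟩

_⟨_←_⟩ : ∀ {n} → P₂ n → Fin n → Fin n → P₂ n
(f ⟨ i ← j ⟩) x = f (x [ i ]≔ lookup x j)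

essentialPairs : ∀ {n} → P₂ n → List (Fin n × Fin n)
essentialPairs {n} f = filter
  (λ (i , j) → i ∈? Ess f ×-dec j ∈? Ess f ×-dec ¬? (i Fin.≟ j))
  (cartesianProduct (allFin n) (allFin n))

-- The truncated subtraction is exact, because an identification minor never
-- has more essential variables than f.  The default 0 of max is only the value
-- of the maximum over no pairs, i.e. when ess f < 2 and the gap is
-- conventionally undefined.
gap : ∀ {n} → P₂ n → ℕ
gap f = ess f ∸ max 0 (map (λ (i , j) → ess (f ⟨ i ← j ⟩)) (essentialPairs f))

{-# OPTIONS --safe #-}
-- The only identification minors of f are, up to renaming, the diagonal
-- x ↦ f(x,x).  Hence, for ess(f) = 2, the gap is 2 exactly when f(0,0) = f(1,1);
-- in that case f depends on both variables iff some off-diagonal value differs from f(0,0).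
-- Since ess and gap depend only on the values of f, this criterion is checked
-- on the sixteen truth tables.
module Submission where

open import Data.Bool using (Bool; true; false; _∧_; _xor_)
open import Data.Bool.Properties using (∧-identityʳ; ∧-zeroʳ; xor-identityʳ)
import Data.Bool as Bool
open import Data.Fin using (Fin)
import Data.Fin as Fin
open import Data.Fin.Subset using (Subset; ∣_∣)
open import Data.Fin.Subset.Properties using (anySubset?; _∈?_)
open import Data.List using (List; map; filter; allFin; cartesianProduct)
open import Data.List.Extrema.Nat using (max)
open import Data.List.Properties using (map-cong)
open import Data.Nat using (_∸_)
import Data.Nat as ℕ
open import Data.Product using (_×_; _,_; proj₁; proj₂; ∃-syntax)
open import Data.Sum using (_⊎_)
open import Data.Vec using (Vec; []; _∷_; lookup; _[_]≔_)
open import Data.Vec.Properties using (tabulate-cong)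
open import Function.Bundles using (_⇔_; mk⇔)
open import Relation.Binary.PropositionalEquality
  using (_≡_; _≢_; _≗_; refl; sym; trans; cong; cong₂)
open import Relation.Nullary
  using (Dec; does; ¬?; _×-dec_; _⊎-dec_; _→-dec_; decidable-stable)
open import Relation.Nullary.Decidable using (from-no; does-⇔)
open import Defs

-- A function agrees with the one rebuilt from its truth table only pointwise, so each notion has to
-- be transported along `≗`.
Essential-cong : ∀ {n} {f g : P₂ n} → f ≗ g → ∀ i → Essential f i → Essential g i
Essential-cong f≗g i (x , fx′≢fx) =
  x , λ gx′≡gx → fx′≢fx (trans (f≗g _) (trans gx′≡gx (sym (f≗g x))))

Ess-cong : ∀ {n} {f g : P₂ n} → f ≗ g → Ess f ≡ Ess g
Ess-cong {f = f} {g} f≗g = tabulate-cong λ i →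
  -- `Ess` records only the Boolean verdicts of two separate searches, so logical equivalence
  -- suffices for equal bits.
  does-⇔ (mk⇔ (Essential-cong f≗g i) (Essential-cong (λ x → sym (f≗g x)) i))
    (essential? f i) (essential? g i)

ess-cong : ∀ {n} {f g : P₂ n} → f ≗ g → ess f ≡ ess g
ess-cong f≗g = cong ∣_∣ (Ess-cong f≗g)

essentialPairs-cong : ∀ {n} {f g : P₂ n} → f ≗ g → essentialPairs f ≡ essentialPairs g
essentialPairs-cong {n} f≗g = cong pairs (Ess-cong f≗g)
  where
  -- The function enters the filter only through its set of essential variables; abstracting that
  -- set reduces the claim to `Ess-cong`.
  pairs : Subset n → List (Fin n × Fin n)
  pairs S = filter
    (λ (i , j) → i ∈? S ×-dec j ∈? S ×-dec ¬? (i Fin.≟ j))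
    (cartesianProduct (allFin n) (allFin n))

gap-cong : ∀ {n} {f g : P₂ n} → f ≗ g → gap f ≡ gap g
gap-cong {f = f} {g} f≗g = cong₂ _∸_ (ess-cong f≗g) (cong (max 0) (trans
  -- First the minors are exchanged over the fixed pair list of `f`, then the list itself.
  (map-cong (λ (i , j) → ess-cong (λ x → f≗g (x [ i ]≔ lookup x j))) (essentialPairs f))
  (cong (map (λ (i , j) → ess (g ⟨ i ← j ⟩))) (essentialPairs-cong f≗g))))

InG : P₂ 2 → Set
InG f = ess f ≡ 2 × gap f ≡ 2

inG? : ∀ f → Dec (InG f)
inG? f = (ess f ℕ.≟ 2) ×-dec (gap f ℕ.≟ 2)

ConstantOnlyOnDiagonal : P₂ 2 → Set
ConstantOnlyOnDiagonal f = f (true ∷ true ∷ []) ≡ f₀ ×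
  (f (false ∷ true ∷ []) ≢ f₀ ⊎ f (true ∷ false ∷ []) ≢ f₀)
  where f₀ = f (false ∷ false ∷ [])

constantOnlyOnDiagonal? : ∀ f → Dec (ConstantOnlyOnDiagonal f)
constantOnlyOnDiagonal? f =
  (_ Bool.≟ _) ×-dec (¬? (_ Bool.≟ _) ⊎-dec ¬? (_ Bool.≟ _))

-- Values are listed in the order 00, 01, 10, 11. As `Vec Bool 4` is `Subset 4`, `anySubset?` can
-- search all binary functions.
fromTable : Vec Bool 4 → P₂ 2
fromTable (a ∷ b ∷ c ∷ d ∷ []) (false ∷ false ∷ []) = a
fromTable (a ∷ b ∷ c ∷ d ∷ []) (false ∷ true  ∷ []) = b
fromTable (a ∷ b ∷ c ∷ d ∷ []) (true  ∷ false ∷ []) = c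
fromTable (a ∷ b ∷ c ∷ d ∷ []) (true  ∷ true  ∷ []) = d

toTable : P₂ 2 → Vec Bool 4
toTable f = f (false ∷ false ∷ []) ∷ f (false ∷ true ∷ [])
          ∷ f (true ∷ false ∷ []) ∷ f (true ∷ true ∷ []) ∷ []

fromTable-toTable : ∀ f → fromTable (toTable f) ≗ f
fromTable-toTable f (false ∷ false ∷ []) = refl
fromTable-toTable f (false ∷ true  ∷ []) = refl
fromTable-toTable f (true  ∷ false ∷ []) = refl
fromTable-toTable f (true  ∷ true  ∷ []) = refl

InG-cong : ∀ f g → f ≗ g → InG f → InG g
InG-cong f g f≗g (ess≡2 , gap≡2) =
  trans (sym (ess-cong f≗g)) ess≡2 , trans (sym (gap-cong f≗g)) gap≡2

DiagonalCriterion : P₂ 2 → Set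
DiagonalCriterion f =
  (InG f → ConstantOnlyOnDiagonal f) × (ConstantOnlyOnDiagonal f → InG f)

diagonalCriterion? : ∀ f → Dec (DiagonalCriterion f)
diagonalCriterion? f =
  (inG? f →-dec constantOnlyOnDiagonal? f) ×-dec (constantOnlyOnDiagonal? f →-dec inG? f)

-- The search for a counterexample among all tables evaluates to `no`; decidability of the criterion
-- then removes the double negation.
fromTable-diagonalCriterion : ∀ t → DiagonalCriterion (fromTable t)
fromTable-diagonalCriterion t = decidable-stable (diagonalCriterion? (fromTable t))
  λ ¬criterion →
    from-no (anySubset? λ s → ¬? (diagonalCriterion? (fromTable s))) (t , ¬criterion)

diagonalCriterion : ∀ f → DiagonalCriterion f
diagonalCriterion f =
  let table = fromTable (toTable f)
      to , from = fromTable-diagonalCriterion (toTable f)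
  in (λ f∈G → to (InG-cong f table (λ x → sym (fromTable-toTable f x)) f∈G)) ,
     (λ c → InG-cong table f (fromTable-toTable f) (from c))

-- At each point exactly one of the three indicator factors is 1, so only its coefficient survives.
normalForm : ∀ a₀ a₁ a₂ x₁ x₂ →
  fromTable (a₀ ∷ a₁ ∷ a₂ ∷ a₀ ∷ []) (x₁ ∷ x₂ ∷ []) ≡
    (a₀ ∧ ((x₁ ^ false ∧ x₂ ^ false) xor (x₁ ^ true ∧ x₂ ^ true)))
    xor (a₁ ∧ x₁ ^ false ∧ x₂ ^ true)
    xor (a₂ ∧ x₁ ^ true ∧ x₂ ^ false)
normalForm a₀ a₁ a₂ false false
  rewrite ∧-identityʳ a₀ | ∧-zeroʳ a₁ | ∧-zeroʳ a₂ = sym (xor-identityʳ a₀)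
normalForm a₀ a₁ a₂ false true
  rewrite ∧-zeroʳ a₀ | ∧-identityʳ a₁ | ∧-zeroʳ a₂ = sym (xor-identityʳ a₁)
normalForm a₀ a₁ a₂ true false
  -- Here the last summand survives, so only zeros on the left of `xor` remain, and these compute
  -- away.
  rewrite ∧-zeroʳ a₀ | ∧-zeroʳ a₁ | ∧-identityʳ a₂ = refl
normalForm a₀ a₁ a₂ true true
  rewrite ∧-identityʳ a₀ | ∧-zeroʳ a₁ | ∧-zeroʳ a₂ = sym (xor-identityʳ a₀)

theorem3p1 : (f : P₂ 2) →
    (ess f ≡ 2 × gap f ≡ 2) ⇔
    (∃[ a₀ ] ∃[ a₁ ] ∃[ a₂ ]
    (a₁ ≢ a₀ ⊎ a₂ ≢ a₀) ×
    ((x₁ x₂ : Bool) → f (x₁ ∷ x₂ ∷ []) ≡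
    (a₀ ∧ ((x₁ ^ false ∧ x₂ ^ false) xor (x₁ ^ true ∧ x₂ ^ true)))
    xor (a₁ ∧ x₁ ^ false ∧ x₂ ^ true)
    xor (a₂ ∧ x₁ ^ true ∧ x₂ ^ false)))
theorem3p1 f = mk⇔ to from
  where
  to : InG f → _
  to f∈G with proj₁ (diagonalCriterion f) f∈G
  -- The coefficients are the values of `f` at 00, 01 and 10; the value at 11 is recovered from the
  -- diagonal equality.
  ... | f₁₁≡f₀₀ , offDiagonal = a₀ , a₁ , a₂ , offDiagonal , λ x₁ x₂ →
    trans (values x₁ x₂) (normalForm a₀ a₁ a₂ x₁ x₂)
    where
    a₀ = f (false ∷ false ∷ [])
    a₁ = f (false ∷ true ∷ [])
    a₂ = f (true ∷ false ∷ [])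

    values : ∀ x₁ x₂ → f (x₁ ∷ x₂ ∷ []) ≡ fromTable (a₀ ∷ a₁ ∷ a₂ ∷ a₀ ∷ []) (x₁ ∷ x₂ ∷ [])
    values false false = refl
    values false true  = refl
    values true  false = refl
    values true  true  = f₁₁≡f₀₀

  from : _ → InG f
  from (a₀ , a₁ , a₂ , offDiagonal , f≡) =
    InG-cong g f
      (λ { (x₁ ∷ x₂ ∷ []) → trans (normalForm a₀ a₁ a₂ x₁ x₂) (sym (f≡ x₁ x₂)) })
      -- The table of `g` has `a₀` at both ends, so its diagonal equality is `refl` and the
      -- off-diagonal condition is literally the hypothesis.
      (proj₂ (diagonalCriterion g) (refl , offDiagonal))
    where
    g = fromTable (a₀ ∷ a₁ ∷ a₂ ∷ a₀ ∷ [])
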